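{- Let $C$ and $C'$ be comparator networks on $n$ channels. If $C$ co-subsumes $C'$ and there is a sorting network of the form $N;C$, then there is a generalized sorting network of the form $N';C'$ of the same size and depth as $N;C$.
   Context: A comparator network on $n$ channels is a finite sequence $L_1,\ldots,L_d$ of layers, where each layer is a non-empty set of ordered pairs (comparators) $(i,j)$ with $1\le i<j\le n$, and any two distinct comparators in the same layer are disjoint as sets of channels. Its depth is $d$ and its size is the total number of comparators in all its layers. A generalized comparator network is defined in the same way, except that comparators $(i,j)$ with $i>j$ (generalized comparators) are also allowed. A (generalized) comparator network acts on $\vec x\in\{0,1\}^n$ by applying the layers in order: for each comparator $(i,j)$ of the layer, the values on channels $i$ and $j$ are interchanged if the current value on channel $i$ is larger than the one on channel $j$. $C(\vec x)$ denotes the output of $C$ on $\vec x$. A (generalized) comparator network is a (generalized) sorting network if its output is sorted in non-decreasing order of channel number for every $\vec x\in\{0,1\}^n$. $N;C$ denotes the concatenation of networks (first $N$, then $C$). For a comparator network $C$ on $n$ channels, put $\mathsf{sorts}(C)=\{\vec x\in\{0,1\}^n : C(\vec x)\text{ is sorted}\}$. A permutation $\pi$ of $\{1,\ldots,n\}$ acts on vectors by permuting positions, $\pi(\vec x)_{\pi(i)}=x_i$, and on sets of vectors elementwise. $C$ co-subsumes $C'$ if there is a permutation $\pi$ of $\{1,\ldots,n\}$ with $\pi(\mathsf{sorts}(C))\subseteq\mathsf{sorts}(C')$.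
   Formalization: As stated the claim fails if C′ is deeper or larger than C; the formal theorem gives N′ of the same size and depth as N for all C, C′, and N′;C′ of the same size (depth) as N;C whenever C and C′ have equal size (depth). -}

module Defs where

open import Data.Bool.Base using (Bool; if_then_else_) renaming (_≤_ to _≤ᵇ_)
open import Data.Bool.Properties using () renaming (_<?_ to _<ᵇ?_)
open import Data.Fin.Base using (Fin; _<_; _≤_)
open import Data.Fin.Permutation using (Permutation′; _⟨$⟩ˡ_)
open import Data.List.Base using (List; []; _++_; foldl; length; map)
open import Data.List.Relation.Unary.All using (All)
open import Data.List.Relation.Unary.AllPairs using (AllPairs)
open import Data.Nat.Base using (ℕ)
open import Data.Nat.ListAction using (sum)
open import Data.Product.Base using (_×_; _,_; ∃-syntax)
open import Data.Vec.Base using (Vec; lookup; tabulate; _[_]≔_)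
open import Level using (0ℓ)
open import Relation.Binary.PropositionalEquality.Core using (_≡_; _≢_)
open import Relation.Nullary.Decidable.Core using (does)
open import Relation.Unary using (Pred; _∈_; _⊆_)

infixr 5 _⨾_

Comparator : ℕ → Set
Comparator n = Fin n × Fin n

-- A layer is a set of comparators, listed in an arbitrary order.  Repetitions
-- are excluded by IsLayer, since a comparator is not disjoint from itself.
Layer : ℕ → Set
Layer n = List (Comparator n)

Network : ℕ → Set
Network n = List (Layer n)

Standard : ∀ {n} → Pred (Comparator n) 0ℓ
Standard (i , j) = i < j

-- i < j or i > j
Generalized : ∀ {n} → Pred (Comparator n) 0ℓ
Generalized (i , j) = i ≢ j

Disjoint : ∀ {n} → Comparator n → Comparator n → Set
Disjoint (i , j) (k , l) = i ≢ k × i ≢ l × j ≢ k × j ≢ l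

IsLayer : ∀ {n} → Pred (Comparator n) 0ℓ → Pred (Layer n) 0ℓ
IsLayer P L = L ≢ [] × All P L × AllPairs Disjoint L

IsComparatorNetwork : ∀ {n} → Pred (Network n) 0ℓ
IsComparatorNetwork = All (IsLayer Standard)

IsGeneralizedComparatorNetwork : ∀ {n} → Pred (Network n) 0ℓ
IsGeneralizedComparatorNetwork = All (IsLayer Generalized)

depth : ∀ {n} → Network n → ℕ
depth = length

size : ∀ {n} → Network n → ℕ
size C = sum (map length C)

_⨾_ : ∀ {n} → Network n → Network n → Network n
N ⨾ C = N ++ C

applyComparator : ∀ {n} → Vec Bool n → Comparator n → Vec Bool n
applyComparator x (i , j) =
  if does (lookup x j <ᵇ? lookup x i)
  then (x [ i ]≔ lookup x j) [ j ]≔ lookup x i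
  else x

-- The comparators of a layer are pairwise disjoint, so the order in which they
-- are listed does not affect the result.
applyLayer : ∀ {n} → Vec Bool n → Layer n → Vec Bool n
applyLayer = foldl applyComparator

run : ∀ {n} → Network n → Vec Bool n → Vec Bool n
run C x = foldl applyLayer x C

Sorted : ∀ {n} → Pred (Vec Bool n) 0ℓ
Sorted x = ∀ i j → i ≤ j → lookup x i ≤ᵇ lookup x j

sorts : ∀ {n} → Network n → Pred (Vec Bool n) 0ℓ
sorts C x = Sorted (run C x)

IsSortingNetwork : ∀ {n} → Pred (Network n) 0ℓ
IsSortingNetwork C = IsComparatorNetwork C × (∀ x → x ∈ sorts C)

IsGeneralizedSortingNetwork : ∀ {n} → Pred (Network n) 0ℓ
IsGeneralizedSortingNetwork C =
  IsGeneralizedComparatorNetwork C × (∀ x → x ∈ sorts C)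

-- π(x) at position π(i) is x at position i, hence the inverse permutation here.
permute : ∀ {n} → Permutation′ n → Vec Bool n → Vec Bool n
permute π x = tabulate λ k → lookup x (π ⟨$⟩ˡ k)

permuteSet : ∀ {n} → Permutation′ n → Pred (Vec Bool n) 0ℓ → Pred (Vec Bool n) 0ℓ
permuteSet π S y = ∃[ x ] x ∈ S × y ≡ permute π x

_CoSubsumes_ : ∀ {n} → Network n → Network n → Set
C CoSubsumes C′ = ∃[ π ] permuteSet π (sorts C) ⊆ sorts C′

{-# OPTIONS --safe #-}

-- Relabelling the channels of N by π yields a network that conjugates N by the
-- action of π on vectors.  Hence π(N) sends y to π(N(π⁻¹ y)), and N(π⁻¹ y) lies
-- in sorts C, so co-subsumption places the output of π(N) in sorts C′.  Only
-- the orientation of comparators can be lost by the relabelling.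
module Submission where

open import Defs
open import Data.Bool.Base using (Bool; true; false)
open import Data.Bool.Properties using () renaming (_<?_ to _<ᵇ?_)
open import Data.Fin.Permutation
  using (Permutation′; _⟨$⟩ʳ_; _⟨$⟩ˡ_; inverseˡ; inverseʳ; flip)
open import Data.Fin.Properties using (_≟_; <⇒≢)
open import Data.List.Base using ([]; _∷_; length; map)
open import Data.List.Properties
  using (foldl-++; length-map; length-++; map-++)
open import Data.List.Relation.Unary.All as All using ()
open import Data.List.Relation.Unary.All.Properties as All using (++⁻ˡ; ++⁺)
open import Data.List.Relation.Unary.AllPairs as AllPairs using ()
open import Data.List.Relation.Unary.AllPairs.Properties as AllPairs using ()
open import Data.Nat.Base using (ℕ; _+_)
open import Data.Nat.ListAction using (sum)
open import Data.Nat.ListAction.Properties using (sum-++)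
open import Data.Product.Base using (_×_; _,_; ∃-syntax)
open import Data.Vec.Base using (Vec; lookup; _[_]≔_)
open import Data.Vec.Properties
  using (lookup∘tabulate; tabulate∘lookup; tabulate-cong; lookup∘update; lookup∘update′)
open import Function.Base using (_∘_)
open import Relation.Binary.PropositionalEquality
open import Relation.Nullary.Decidable.Core using (does; yes; no)

open ≡-Reasoning

-- The endpoints are not put back in increasing order. The first channel of a comparator receives
-- the smaller value, so its image under `π` has to stay first, even where this gives a generalized
-- comparator.
relabelComparator : ∀ {n} → Permutation′ n → Comparator n → Comparator n
relabelComparator π (i , j) = π ⟨$⟩ʳ i , π ⟨$⟩ʳ j

relabelLayer : ∀ {n} → Permutation′ n → Layer n → Layer n
relabelLayer π = map (relabelComparator π)

relabel : ∀ {n} → Permutation′ n → Network n → Network n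
relabel π = map (relabelLayer π)

⟨$⟩ʳ-≢ : ∀ {n} (π : Permutation′ n) {i j} → i ≢ j → π ⟨$⟩ʳ i ≢ π ⟨$⟩ʳ j
⟨$⟩ʳ-≢ π i≢j πi≡πj =
  i≢j (trans (sym (inverseˡ π)) (trans (cong (π ⟨$⟩ˡ_) πi≡πj) (inverseˡ π)))

lookup-permute : ∀ {n} (π : Permutation′ n) x i →
                 lookup (permute π x) (π ⟨$⟩ʳ i) ≡ lookup x i
lookup-permute π x i =
  trans (lookup∘tabulate _ (π ⟨$⟩ʳ i)) (cong (lookup x) (inverseˡ π))

-- Every position is `π ⟨$⟩ʳ i` for some `i`, so checking those positions suffices. Pointwise
-- arguments then avoid the inverse that occurs in the definition of `permute`.
permute-unique : ∀ {n} (π : Permutation′ n) x y →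
                 (∀ i → lookup y (π ⟨$⟩ʳ i) ≡ lookup x i) → y ≡ permute π x
permute-unique π x y eq = trans (sym (tabulate∘lookup y)) (tabulate-cong λ k →
  trans (cong (lookup y) (sym (inverseʳ π))) (eq (π ⟨$⟩ˡ k)))

-- The action is surjective: an arbitrary input can be brought into the form `permute π x` on which
-- the conjugation lemmas are stated.
permute-flip : ∀ {n} (π : Permutation′ n) y → y ≡ permute π (permute (flip π) y)
permute-flip π y = permute-unique π (permute (flip π) y) y λ i →
  sym (lookup∘tabulate (λ k → lookup y (π ⟨$⟩ʳ k)) i)

permute-[]≔ : ∀ {n} (π : Permutation′ n) x i b →
              permute π x [ π ⟨$⟩ʳ i ]≔ b ≡ permute π (x [ i ]≔ b)
permute-[]≔ π x i b = permute-unique π (x [ i ]≔ b) _ pointwise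
  where
  pointwise : ∀ k → lookup (permute π x [ π ⟨$⟩ʳ i ]≔ b) (π ⟨$⟩ʳ k) ≡ lookup (x [ i ]≔ b) k
  pointwise k with k ≟ i
  ... | yes refl = trans (lookup∘update (π ⟨$⟩ʳ i) (permute π x) b)
                         (sym (lookup∘update i x b))
  ... | no k≢i = begin
    lookup (permute π x [ π ⟨$⟩ʳ i ]≔ b) (π ⟨$⟩ʳ k) ≡⟨ lookup∘update′ (⟨$⟩ʳ-≢ π k≢i) (permute π x) b ⟩
    lookup (permute π x) (π ⟨$⟩ʳ k)                 ≡⟨ lookup-permute π x k ⟩
    lookup x k                                      ≡⟨ lookup∘update′ k≢i x b ⟨
    lookup (x [ i ]≔ b) k                           ∎

applyComparator-relabel : ∀ {n} (π : Permutation′ n) x c →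
  applyComparator (permute π x) (relabelComparator π c) ≡ permute π (applyComparator x c)
applyComparator-relabel π x (i , j)
  -- A comparator depends on its channels only through the values found there. After rewriting, both
  -- sides test the same two values, so one case split decides both.
  rewrite lookup-permute π x i | lookup-permute π x j
  with does (lookup x j <ᵇ? lookup x i)
... | false = refl
... | true = begin
  (permute π x [ π ⟨$⟩ʳ i ]≔ lookup x j) [ π ⟨$⟩ʳ j ]≔ lookup x i ≡⟨ cong (_[ π ⟨$⟩ʳ j ]≔ lookup x i) (permute-[]≔ π x i (lookup x j)) ⟩
  permute π (x [ i ]≔ lookup x j) [ π ⟨$⟩ʳ j ]≔ lookup x i         ≡⟨ permute-[]≔ π (x [ i ]≔ lookup x j) j (lookup x i) ⟩
  permute π ((x [ i ]≔ lookup x j) [ j ]≔ lookup x i)              ∎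

applyLayer-relabel : ∀ {n} (π : Permutation′ n) x L →
  applyLayer (permute π x) (relabelLayer π L) ≡ permute π (applyLayer x L)
applyLayer-relabel π x [] = refl
applyLayer-relabel π x (c ∷ L) = trans
  (cong (λ y → applyLayer y (relabelLayer π L)) (applyComparator-relabel π x c))
  (applyLayer-relabel π (applyComparator x c) L)

run-relabel : ∀ {n} (π : Permutation′ n) N x →
              run (relabel π N) (permute π x) ≡ permute π (run N x)
run-relabel π [] x = refl
run-relabel π (L ∷ N) x = trans
  (cong (run (relabel π N)) (applyLayer-relabel π x L))
  (run-relabel π N (applyLayer x L))

run-⨾ : ∀ {n} (N C : Network n) x → run (N ⨾ C) x ≡ run C (run N x)
run-⨾ N C x = foldl-++ applyLayer x N C

size-⨾ : ∀ {n} (N C : Network n) → size (N ⨾ C) ≡ size N + size C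
size-⨾ N C = trans (cong sum (map-++ length N C)) (sum-++ (map length N) (map length C))

size-relabel : ∀ {n} (π : Permutation′ n) N → size (relabel π N) ≡ size N
size-relabel π []      = refl
size-relabel π (L ∷ N) = cong₂ _+_ (length-map (relabelComparator π) L) (size-relabel π N)

standard⇒generalized : ∀ {n} {L : Layer n} → IsLayer Standard L → IsLayer Generalized L
standard⇒generalized (L≢[] , std , disj) = L≢[] , All.map <⇒≢ std , disj

-- Apart from non-emptiness, a generalized layer is described by inequations between channels alone,
-- and these survive any injective relabelling. The order `i < j` need not survive, hence
-- `Generalized` in place of `Standard`.
relabel-isLayer : ∀ {n} (π : Permutation′ n) {L} →
                  IsLayer Generalized L → IsLayer Generalized (relabelLayer π L)
-- Relabelling `[]` computes to `[]`, so the contradictory `L≢[]` already has the required type.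
relabel-isLayer π {[]}    (L≢[] , _)      = L≢[] , All.[] , AllPairs.[]
relabel-isLayer π {_ ∷ _} (_ , gen , disj) =
    (λ ())
  , All.map⁺ (All.map (⟨$⟩ʳ-≢ π) gen)
  , AllPairs.map⁺ (AllPairs.map
      (λ (i≢k , i≢l , j≢k , j≢l) → ⟨$⟩ʳ-≢ π i≢k , ⟨$⟩ʳ-≢ π i≢l , ⟨$⟩ʳ-≢ π j≢k , ⟨$⟩ʳ-≢ π j≢l)
      disj)

-- Co-subsumption does not compare `C` and `C′` in size or depth. The prefixes always agree in both,
-- while each equality for the whole networks is conditional on the corresponding one for the
-- suffixes.
lemma10 : ∀ (n : ℕ) (C C′ : Network n) →
    IsComparatorNetwork C → IsComparatorNetwork C′ →
    C CoSubsumes C′ →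
    ∀ (N : Network n) → IsSortingNetwork (N ⨾ C) →
    ∃[ N′ ] IsGeneralizedSortingNetwork (N′ ⨾ C′)
    × size N′ ≡ size N
    × depth N′ ≡ depth N
    × (size C ≡ size C′ → size (N′ ⨾ C′) ≡ size (N ⨾ C))
    × (depth C ≡ depth C′ → depth (N′ ⨾ C′) ≡ depth (N ⨾ C))
lemma10 n C C′ _ isC′ (π , π[sortsC]⊆sortsC′) N (isN⨾C , N⨾C-sorts) =
  N′ , (isN′⨾C′ , N′⨾C′-sorts) , size-N′ , depth-N′ , size-eq , depth-eq
  where
  N′ : Network n
  N′ = relabel π N

  isN′⨾C′ : IsGeneralizedComparatorNetwork (N′ ⨾ C′)
  isN′⨾C′ = ++⁺
    (All.map⁺ (All.map (relabel-isLayer π ∘ standard⇒generalized) (++⁻ˡ N isN⨾C)))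
    (All.map standard⇒generalized isC′)

  N′-output : ∀ y → run N′ y ≡ permute π (run N (permute (flip π) y))
  N′-output y = trans (cong (run N′) (permute-flip π y)) (run-relabel π N (permute (flip π) y))

  N′⨾C′-sorts : ∀ y → sorts (N′ ⨾ C′) y
  -- The preimage witnessing membership in `permuteSet π (sorts C)` is `run N x`: applying `C` to it
  -- completes the run of `N ⨾ C` on `x`, whose output is sorted.
  N′⨾C′-sorts y = subst Sorted (sym (run-⨾ N′ C′ y)) (π[sortsC]⊆sortsC′
    (run N x , subst Sorted (run-⨾ N C x) (N⨾C-sorts x) , N′-output y))
    where
    x : Vec Bool n
    x = permute (flip π) y

  size-N′ : size N′ ≡ size N
  size-N′ = size-relabel π N

  depth-N′ : depth N′ ≡ depth N
  depth-N′ = length-map (relabelLayer π) N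

  size-eq : size C ≡ size C′ → size (N′ ⨾ C′) ≡ size (N ⨾ C)
  size-eq eq = trans (size-⨾ N′ C′) (trans (cong₂ _+_ size-N′ (sym eq)) (sym (size-⨾ N C)))

  depth-eq : depth C ≡ depth C′ → depth (N′ ⨾ C′) ≡ depth (N ⨾ C)
  depth-eq eq = trans (length-++ N′) (trans (cong₂ _+_ depth-N′ (sym eq)) (sym (length-++ N)))
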